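{- Let $X,Y,Z_p$ be variables satisfying $XY-qYX=hf(Y)Z_p$, $Z_pY=pYZ_p$, $XZ_p=pZ_pX$, $Z_1=I$, where $f(y)=\sum_{j=0}^s\alpha_jy^j$ is a polynomial. Then for every $m\in\mathbb{N}_0$ the normal ordered form of $X^mY$ is given by $$X^mY=\sum_{j=0}^mh^j\Big(\sum_{\lambda\in\mathcal{I}_{m-j,j}}q^{m-j-|\lambda|}p^{|\lambda|}g_j(\lambda;Y)\Big)Z_p^jX^{m-j}.$$
   Context: $p,q$ are two commuting indeterminates and $h$ is a scalar; $p,q,h$ are central scalars in the unital associative algebra containing $X,Y,Z_p$. The convention $Z_1=I$ means that $Z_p$ is the identity when $p=1$. Normal ordered form: a linear combination of monomials $Y^aZ_p^bX^c$. $[n]_{p,q}=\frac{p^n-q^n}{p-q}$. $\mathcal{I}_{\ell,k}$ is the set of Young diagrams contained in an $\ell\times k$ box ($\ell$ rows, $k$ columns), the diagram of $\lambda$ having $\lambda_i$ boxes in column $i$; that is, $\mathcal{I}_{\ell,k}$ is identified with the set of sequences $\lambda=(\lambda_1,\dots,\lambda_k)$ of integers with $\ell\ge\lambda_1\ge\cdots\ge\lambda_k\ge0$ (for $k=0$ only the empty partition). $|\lambda|=\sum_i\lambda_i$. For $\lambda=(\lambda_1,\dots,\lambda_d)$ with $d\ge1$ parts, $$g_d(\lambda;Y)=\sum_{i_1,\dots,i_d=0}^s\Big(q^{\sum_{j=1}^di_j\lambda_j}\prod_{j=1}^d\alpha_{i_j}\prod_{j=1}^{d-1}[i_1+\cdots+i_j+1-j]_{p,q}\Big)Y^{i_1+\cdots+i_d+1-d},$$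 and $g_0(\emptyset;Y)=Y$. Summands containing a factor $[0]_{p,q}=0$ are read as zero (in particular negative powers of $Y$ do not occur). -}

module Defs where

open import Level using (Level; _⊔_; suc)
open import Algebra.Bundles using (CommutativeRing; Ring)
open import Algebra.Definitions using (Invertible)
open import Algebra.Morphism.Structures using (module RingMorphisms)
import Algebra.Properties.Semiring.Exp as Exp
open import Data.Nat.Base as ℕ using (ℕ; _∸_)
open import Data.Nat.Properties using (_≥?_)
open import Data.Integer.Base using (ℤ; +_; -[1+_])
open import Data.Fin.Base using (Fin; toℕ)
open import Data.List.Base as List using (List; []; _∷_; upTo; applyUpTo; allFin)
open import Data.Vec.Base as Vec using (Vec; []; _∷_)
open import Data.Vec.Relation.Unary.Linked using (linked?)
open import Data.Product.Base using (Σ-syntax; _×_; _,_; proj₁)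

private
  variable
    a ℓ b : Level

-- All sequences of length d with entries drawn from a list.
tuples : {B : Set b} → List B → (d : ℕ) → List (Vec B d)
tuples xs ℕ.zero    = [] ∷ []
tuples xs (ℕ.suc d) = List.cartesianProductWith _∷_ xs (tuples xs d)

-- 𝓘 r k enumerates, without repetition, the sequences r ≥ λ₁ ≥ ⋯ ≥ λₖ ≥ 0.
𝓘 : (r k : ℕ) → List (Vec ℕ k)
𝓘 r k = List.filter (linked? _≥?_) (tuples (upTo (ℕ.suc r)) k)

∣_∣ : ∀ {k} → Vec ℕ k → ℕ
∣_∣ = Vec.sum

-- Unital associative algebras over a commutative ring, given by the structure
-- map c ↦ c · 1, whose image is central.
record UnitalAlgebra {c ℓ} (K : CommutativeRing c ℓ) (a ℓ′ : Level)
       : Set (c ⊔ ℓ ⊔ suc (a ⊔ ℓ′)) where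
  private module K = CommutativeRing K
  field
    ring : Ring a ℓ′
  open Ring ring public
  field
    ι : K.Carrier → Carrier
    ι-isRingHomomorphism : RingMorphisms.IsRingHomomorphism K.rawRing rawRing ι
    ι-central : ∀ k x → ι k * x ≈ x * ι k

  infixr 7 _•_
  _•_ : K.Carrier → Carrier → Carrier
  k • x = ι k * x

module RingOps (R : Ring a ℓ) where
  open Ring R
  open Exp semiring public using (_^_)

  sumOver : {B : Set b} → List B → (B → Carrier) → Carrier
  sumOver xs F = List.foldr (λ x acc → F x + acc) 0# xs

  prodOver : {B : Set b} → List B → (B → Carrier) → Carrier
  prodOver xs F = List.foldr (λ x acc → F x * acc) 1# xs

  infix 6 sumOver
  syntax sumOver xs (λ x → e) = ∑[ x ← xs ] e

-- A commutative ring of scalars containing p and q.  Being indeterminates that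
-- occur in the denominator p - q and in negative powers of q, they are subject
-- to the requirement that p - q and q are units.
record PQScalars (c ℓ : Level) : Set (suc (c ⊔ ℓ)) where
  field
    commutativeRing : CommutativeRing c ℓ
  open CommutativeRing commutativeRing public
  field
    p q      : Carrier
    q-unit   : Invertible _≈_ 1# _*_ q
    p-q-unit : Invertible _≈_ 1# _*_ (p - q)
  open RingOps ring public

  [_]pq : ℕ → Carrier
  [ n ]pq = (p ^ n - q ^ n) * proj₁ p-q-unit

  q^ᶻ : ℤ → Carrier
  q^ᶻ (+ n)    = q ^ n
  q^ᶻ -[1+ n ] = proj₁ q-unit ^ ℕ.suc n

-- i₁ + ⋯ + iⱼ + 1 - j, truncated at 0.  Truncation implements the convention
-- on zero summands: the untruncated value starts at 1 for j = 0 and drops by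
-- at most 1 when j increases, so if it is negative for some j then it is 0 for
-- a smaller j ≥ 1.  That summand then has a factor [ 0 ], with or without the
-- truncation; in all other summands nothing is truncated.
height : ∀ {d} → Vec ℕ d → ℕ → ℕ
height i j = ℕ.suc (List.sum (List.take j (Vec.toList i))) ∸ j

module NormalOrdering {c ℓ a ℓ′} (S : PQScalars c ℓ)
  (𝒜 : UnitalAlgebra (PQScalars.commutativeRing S) a ℓ′) where
  private module K = PQScalars S
  open K using (p; q; [_]pq) renaming (_^_ to _^ᴷ_)
  open UnitalAlgebra 𝒜
  open RingOps ring

  -- α₀ + α₁ y + ⋯ + αₛ yˢ
  poly : (s : ℕ) → (Fin (ℕ.suc s) → K.Carrier) → Carrier → Carrier
  poly s α y = ∑[ j ← allFin (ℕ.suc s) ] α j • y ^ toℕ j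

  -- The tuple t is (i₁, …, i_d), with i its entries as natural numbers.
  g : (s : ℕ) → (Fin (ℕ.suc s) → K.Carrier) → ∀ {d} → Vec ℕ d → Carrier → Carrier
  g s α {ℕ.zero}  []  y = y
  g s α {ℕ.suc e} lam y = ∑[ t ← tuples (allFin (ℕ.suc s)) (ℕ.suc e) ]
    (let i = Vec.map toℕ t in
      (q ^ᴷ Vec.sum (Vec.zipWith ℕ._*_ i lam)
        K.* K.prodOver (Vec.toList t) α
        K.* K.prodOver (applyUpTo ℕ.suc e) (λ j → [ height i j ]pq))
      • y ^ height i (ℕ.suc e))

  NormalOrdered : (X Y Z : Carrier) → Carrier → Set (c ⊔ ℓ′)
  NormalOrdered X Y Z e = Σ[ terms ∈ List (K.Carrier × ℕ × ℕ × ℕ) ]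
    e ≈ sumOver terms λ (k , u , v , w) → k • (Y ^ u * Z ^ v * X ^ w)

{-# OPTIONS --safe #-}

-- Induction on m, multiplying X ^ m Y by X on the left.  From
-- X Y ^ n = q ^ n Y ^ n X + h [ n ] Y ^ (n - 1) f Z, moving X past a summand of g_j (λ; Y) Z ^ j
-- produces two terms.  The first has all parts of λ enlarged by 1, since q ^ n supplies the missing
-- powers of q.  The second has a part 0 appended to λ: [ n ] is the new factor of the coefficient,
-- and the coefficients of f supply the new index.  Every partition with j + 1 parts is obtained in
-- exactly one of these two ways, according to whether its last part is positive or 0.
module Submission where

open import Defs
open import Algebra.Bundles using (CommutativeMonoid; Ring)
open import Algebra.Morphism.Structures using (module RingMorphisms)
import Algebra.Properties.CommutativeSemigroup as CommutativeSemigroup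
import Algebra.Properties.CommutativeSemiring.Exp as CommutativeExp
import Algebra.Properties.Ring as RingProperties
import Algebra.Properties.Semiring.Exp as Exp
import Algebra.Solver.CommutativeMonoid as CommutativeMonoidSolver
open import Data.Fin.Base using (Fin; toℕ)
open import Data.Integer.Base using (_⊖_)
import Data.Integer.Properties as ℤ
open import Data.List.Base as List using (List; []; _∷_; _++_; upTo; applyUpTo; allFin)
open import Data.List.Membership.Propositional using (_∈_)
open import Data.List.Membership.Propositional.Properties
  using ( ∈-cartesianProductWith⁺; ∈-cartesianProductWith⁻; ∈-upTo⁺; ∈-upTo⁻; ∈-filter⁺; ∈-filter⁻
        ; ∈-map⁺; ∈-map⁻; ∈-++⁺ˡ; ∈-++⁺ʳ; ∈-++⁻)
open import Data.List.Membership.Propositional.Properties.WithK using (unique∧set⇒bag)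
open import Data.List.Relation.Binary.BagAndSetEquality using (∼bag⇒↭)
open import Data.List.Relation.Binary.Permutation.Propositional as Perm using (_↭_)
import Data.List.Relation.Unary.All as ListAll
import Data.List.Relation.Unary.AllPairs as AllPairs
open import Data.List.Relation.Unary.Any using (here)
open import Data.List.Relation.Unary.Unique.Propositional using (Unique)
import Data.List.Relation.Unary.Unique.Propositional.Properties as Unique
open import Data.Nat.Base as ℕ using (ℕ; zero; suc; _∸_; _≥_; _≤_; z≤n; s≤s)
open import Data.Nat.ListAction using (sum)
import Data.Nat.Properties as ℕ
open import Data.Product.Base using (∃; _×_; _,_; proj₁; proj₂)
open import Data.Sum.Base using (_⊎_; inj₁; inj₂)
open import Data.Vec.Base as Vec using (Vec; []; _∷_; _∷ʳ_)
import Data.Vec.Properties as Vec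
open import Data.Vec.Relation.Unary.All as All using (All; []; _∷_)
open import Data.Vec.Relation.Unary.Linked using (Linked; linked?; []; [-]; _∷_)
open import Function.Base using (_∘_; id)
open import Function.Bundles using (mk⇔)
open import Level using (Level)
open import Relation.Binary.PropositionalEquality as ≡ using (_≡_; _≢_; cong; cong₂)
import Relation.Binary.Reasoning.Setoid as SetoidReasoning
open import Relation.Nullary.Decidable using (yes; no)
open import Relation.Nullary.Negation using (¬_)

-- The powers of `p` balance because `X` must also cross `Z ^ j`: this yields `p ^ j`, which is the
-- growth of `p ^ ∣ λ ∣` when all `j` parts grow by 1. The main obstacle is truncation. The exponent
-- i₁ + ⋯ + i_j + 1 - j is a natural number in the code, so the balance of powers of `q` fails where
-- the true value is negative, and the exponents of `Y` need not match where `Y ^ (n - 1)` is taken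
-- at `n = 0`. In each of these cases the coefficient contains a factor `[ 0 ]`, so both sides are
-- zero; this is why the computations below split on the height. The exponent of `q` outside `g` can
-- be negative as well; there it is handled by splitting off powers of `q⁻¹`.

private
  module ℕ-CommutativeSemigroup = CommutativeSemigroup ℕ.+-commutativeSemigroup

  variable
    a ℓ b b′ : Level
    B : Set b
    B′ : Set b′
    r k : ℕ

-- Partitions in a box, divided by their last part.

tuples⁺ : ∀ {xs : List B} {v : Vec B k} → All (_∈ xs) v → v ∈ tuples xs k
tuples⁺ []       = here ≡.refl
tuples⁺ (p ∷ ps) = ∈-cartesianProductWith⁺ _∷_ p (tuples⁺ ps)

tuples⁻ : ∀ {xs : List B} {v : Vec B k} → v ∈ tuples xs k → All (_∈ xs) v
tuples⁻ {k = zero}  {v = []} _ = []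
tuples⁻ {k = suc k} {xs = xs} v∈
  with _ , _ , x∈ , w∈ , ≡.refl ← ∈-cartesianProductWith⁻ _∷_ xs (tuples xs k) v∈ =
  x∈ ∷ tuples⁻ w∈

tuples-unique : ∀ {xs : List B} → Unique xs → ∀ k → Unique (tuples xs k)
tuples-unique xs! zero    = ListAll.[] AllPairs.∷ AllPairs.[]
tuples-unique xs! (suc k) =
  Unique.cartesianProductWith⁺ _∷_ Vec.∷-injective xs! (tuples-unique xs! k)

Boxed : ℕ → Vec ℕ k → Set
Boxed r v = Linked _≥_ v × All (_≤ r) v

𝓘⁺ : ∀ {v : Vec ℕ k} → Boxed r v → v ∈ 𝓘 r k
𝓘⁺ (dec , bd) = ∈-filter⁺ (linked? ℕ._≥?_) (tuples⁺ (All.map (∈-upTo⁺ ∘ s≤s) bd)) dec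

𝓘⁻ : ∀ {v : Vec ℕ k} → v ∈ 𝓘 r k → Boxed r v
𝓘⁻ {k} {r} v∈ with v∈′ , dec ← ∈-filter⁻ (linked? ℕ._≥?_) {xs = tuples (upTo (suc r)) k} v∈ =
  dec , All.map (ℕ.s≤s⁻¹ ∘ ∈-upTo⁻) (tuples⁻ v∈′)

𝓘-unique : ∀ r k → Unique (𝓘 r k)
𝓘-unique r k = Unique.filter⁺ (linked? ℕ._≥?_) (tuples-unique (Unique.upTo⁺ (suc r)) k)

Boxed-map-suc : ∀ {v : Vec ℕ k} → Boxed r v → Boxed (suc r) (Vec.map suc v)
Boxed-map-suc ([]                , [])     = [] , []
Boxed-map-suc ([-]               , p ∷ []) = [-] , s≤s p ∷ []
Boxed-map-suc {v = _ ∷ _ ∷ _} (x≥y ∷ dec , p ∷ ps)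
  with dec′ , ps′ ← Boxed-map-suc (dec , ps) = s≤s x≥y ∷ dec′ , s≤s p ∷ ps′

Boxed-∷ʳ0 : ∀ {v : Vec ℕ k} → Boxed r v → Boxed r (v ∷ʳ 0)
Boxed-∷ʳ0 ([]  , [])     = [-] , z≤n ∷ []
Boxed-∷ʳ0 ([-] , p ∷ []) = z≤n ∷ [-] , p ∷ z≤n ∷ []
Boxed-∷ʳ0 {v = _ ∷ _ ∷ _} (x≥y ∷ dec , p ∷ ps)
  with dec′ , ps′ ← Boxed-∷ʳ0 (dec , ps) = x≥y ∷ dec′ , p ∷ ps′

-- The last part decides, but the recursion meets the first part first. Monotonicity carries
-- positivity to the left: if the tail is a `map suc`, the head is at least its first entry, hence a
-- successor too, and its bound drops from `suc r` to `r`.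
Boxed-cases : ∀ {v : Vec ℕ (suc k)} → Boxed (suc r) v →
              (∃ λ u → Boxed r u × v ≡ Vec.map suc u) ⊎
              (∃ λ u → Boxed (suc r) u × v ≡ u ∷ʳ 0)
Boxed-cases {v = zero ∷ []}  ([-] , _)          = inj₂ ([] , ([] , []) , ≡.refl)
Boxed-cases {v = suc x ∷ []} ([-] , s≤s p ∷ []) = inj₁ (x ∷ [] , ([-] , p ∷ []) , ≡.refl)
Boxed-cases {v = x ∷ _ ∷ _} (x≥y ∷ dec , p ∷ ps) with Boxed-cases (dec , ps)
Boxed-cases (s≤s x≥y ∷ _ , s≤s p ∷ _) | inj₁ (_ ∷ _ , (dec , ps) , ≡.refl) =
  inj₁ (_ , (x≥y ∷ dec , p ∷ ps) , ≡.refl)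
Boxed-cases (x≥y ∷ _ , p ∷ _) | inj₂ ([] , _ , ≡.refl) =
  inj₂ (_ ∷ [] , ([-] , p ∷ []) , ≡.refl)
Boxed-cases (x≥y ∷ _ , p ∷ _) | inj₂ (_ ∷ _ , (dec , ps) , ≡.refl) =
  inj₂ (_ , (x≥y ∷ dec , p ∷ ps) , ≡.refl)

-- In a box without rows no part is positive, so only the second alternative of `Boxed-cases`
-- survives.
Boxed-zero : ∀ {v : Vec ℕ (suc k)} → Boxed 0 v → ∃ λ u → Boxed 0 u × v ≡ u ∷ʳ 0
Boxed-zero {v = x ∷ []} ([-] , z≤n ∷ []) = [] , ([] , []) , ≡.refl
Boxed-zero {v = x ∷ _ ∷ _} (x≥y ∷ dec , p ∷ ps) with Boxed-zero (dec , ps)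
... | []    , _           , ≡.refl = x ∷ [] , ([-] , p ∷ []) , ≡.refl
... | _ ∷ _ , (dec′ , ps′) , ≡.refl = _ , (x≥y ∷ dec′ , p ∷ ps′) , ≡.refl

map-suc-injective : ∀ {u v : Vec ℕ k} → Vec.map suc u ≡ Vec.map suc v → u ≡ v
map-suc-injective {u = []}    {[]}    _  = ≡.refl
map-suc-injective {u = _ ∷ _} {_ ∷ _} eq =
  cong₂ _∷_ (ℕ.suc-injective (Vec.∷-injectiveˡ eq)) (map-suc-injective (Vec.∷-injectiveʳ eq))

map-suc≢∷ʳ0 : ∀ {u : Vec ℕ (suc k)} {v : Vec ℕ k} → ¬ Vec.map suc u ≡ v ∷ʳ 0
map-suc≢∷ʳ0 {u = _ ∷ []}    {[]}    ()
map-suc≢∷ʳ0 {u = _ ∷ _ ∷ _} {_ ∷ _} eq = map-suc≢∷ʳ0 (Vec.∷-injectiveʳ eq)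

-- `𝓘` lists sequences lexicographically from the first entry, while the division is by the last
-- part, so the two sides differ in order. Both lists are free of repetitions and have the same
-- members, which makes them permutations of each other.
𝓘-split : ∀ r k → 𝓘 (suc r) (suc k) ↭
          List.map (Vec.map suc) (𝓘 r (suc k)) ++ List.map (_∷ʳ 0) (𝓘 (suc r) k)
𝓘-split r k = ∼bag⇒↭ (unique∧set⇒bag (𝓘-unique (suc r) (suc k))
  (Unique.++⁺ (Unique.map⁺ map-suc-injective (𝓘-unique r (suc k)))
              (Unique.map⁺ (Vec.∷ʳ-injectiveˡ _ _) (𝓘-unique (suc r) k))
              disjoint)
  (mk⇔ to from))
  where
  positive = List.map (Vec.map suc) (𝓘 r (suc k))
  disjoint : ∀ {v} → ¬ (v ∈ positive × v ∈ List.map (_∷ʳ 0) (𝓘 (suc r) k))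
  disjoint (p , z) with _ , _ , ≡.refl ← ∈-map⁻ (Vec.map suc) p | _ , _ , eq ← ∈-map⁻ (_∷ʳ 0) z =
    map-suc≢∷ʳ0 eq
  to : ∀ {v} → v ∈ 𝓘 (suc r) (suc k) → v ∈ positive ++ List.map (_∷ʳ 0) (𝓘 (suc r) k)
  to v∈ with Boxed-cases (𝓘⁻ v∈)
  ... | inj₁ (_ , bx , ≡.refl) = ∈-++⁺ˡ (∈-map⁺ (Vec.map suc) (𝓘⁺ bx))
  ... | inj₂ (_ , bx , ≡.refl) = ∈-++⁺ʳ positive (∈-map⁺ (_∷ʳ 0) (𝓘⁺ bx))
  from : ∀ {v} → v ∈ positive ++ List.map (_∷ʳ 0) (𝓘 (suc r) k) → v ∈ 𝓘 (suc r) (suc k)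
  from v∈ with ∈-++⁻ positive v∈
  ... | inj₁ p with _ , u∈ , ≡.refl ← ∈-map⁻ (Vec.map suc) p = 𝓘⁺ (Boxed-map-suc (𝓘⁻ u∈))
  ... | inj₂ z with _ , u∈ , ≡.refl ← ∈-map⁻ (_∷ʳ 0) z       = 𝓘⁺ (Boxed-∷ʳ0 (𝓘⁻ u∈))

𝓘-zero : ∀ k → 𝓘 0 (suc k) ↭ List.map (_∷ʳ 0) (𝓘 0 k)
𝓘-zero k = ∼bag⇒↭ (unique∧set⇒bag (𝓘-unique 0 (suc k))
  (Unique.map⁺ (Vec.∷ʳ-injectiveˡ _ _) (𝓘-unique 0 k)) (mk⇔ to from))
  where
  to : ∀ {v} → v ∈ 𝓘 0 (suc k) → v ∈ List.map (_∷ʳ 0) (𝓘 0 k)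
  to v∈ with _ , bx , ≡.refl ← Boxed-zero (𝓘⁻ v∈) = ∈-map⁺ (_∷ʳ 0) (𝓘⁺ bx)
  from : ∀ {v} → v ∈ List.map (_∷ʳ 0) (𝓘 0 k) → v ∈ 𝓘 0 (suc k)
  from v∈ with _ , u∈ , ≡.refl ← ∈-map⁻ (_∷ʳ 0) v∈ = 𝓘⁺ (Boxed-∷ʳ0 (𝓘⁻ u∈))

-- Effect of the two operations on sums and heights.

sum-map-suc : (v : Vec ℕ k) → Vec.sum (Vec.map suc v) ≡ k ℕ.+ Vec.sum v
sum-map-suc []      = ≡.refl
sum-map-suc {suc k} (x ∷ v) = cong suc (≡.trans (cong (x ℕ.+_) (sum-map-suc v))
  (ℕ-CommutativeSemigroup.x∙yz≈y∙xz x k (Vec.sum v)))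

sum-∷ʳ : (v : Vec ℕ k) (x : ℕ) → Vec.sum (v ∷ʳ x) ≡ Vec.sum v ℕ.+ x
sum-∷ʳ []      x = ℕ.+-identityʳ x
sum-∷ʳ (y ∷ v) x = ≡.trans (cong (y ℕ.+_) (sum-∷ʳ v x)) (≡.sym (ℕ.+-assoc y _ x))

sum-zipWith-*-suc : (i l : Vec ℕ k) → Vec.sum (Vec.zipWith ℕ._*_ i (Vec.map suc l)) ≡
                    Vec.sum i ℕ.+ Vec.sum (Vec.zipWith ℕ._*_ i l)
sum-zipWith-*-suc []      []      = ≡.refl
sum-zipWith-*-suc (x ∷ i) (y ∷ l) = ≡.trans
  (cong₂ ℕ._+_ (ℕ.*-suc x y) (sum-zipWith-*-suc i l))
  (ℕ-CommutativeSemigroup.interchange x (x ℕ.* y) (Vec.sum i) _)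

sum-zipWith-*-∷ʳ0 : (i l : Vec ℕ k) (x : ℕ) →
  Vec.sum (Vec.zipWith ℕ._*_ (i ∷ʳ x) (l ∷ʳ 0)) ≡ Vec.sum (Vec.zipWith ℕ._*_ i l)
sum-zipWith-*-∷ʳ0 []      []      x = cong (ℕ._+ 0) (ℕ.*-zeroʳ x)
sum-zipWith-*-∷ʳ0 (y ∷ i) (z ∷ l) x = cong (y ℕ.* z ℕ.+_) (sum-zipWith-*-∷ʳ0 i l x)

take-∷ʳ : ∀ {j} (v : Vec B k) (x : B) → j ≤ k →
          List.take j (Vec.toList (v ∷ʳ x)) ≡ List.take j (Vec.toList v)
take-∷ʳ v       x z≤n       = ≡.refl
take-∷ʳ (y ∷ v) x (s≤s j≤k) = cong (y ∷_) (take-∷ʳ v x j≤k)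

height-∷ʳ : ∀ {j} (i : Vec ℕ k) x → j ≤ k → height (i ∷ʳ x) j ≡ height i j
height-∷ʳ {j = j} i x j≤k = cong (λ xs → suc (sum xs) ∸ j) (take-∷ʳ i x j≤k)

sum-take-toList : (i : Vec ℕ k) → sum (List.take k (Vec.toList i)) ≡ Vec.sum i
sum-take-toList []      = ≡.refl
sum-take-toList (x ∷ i) = cong (x ℕ.+_) (sum-take-toList i)

height-full : (i : Vec ℕ k) → height i k ≡ suc (Vec.sum i) ∸ k
height-full {k} i = cong (λ n → suc n ∸ k) (sum-take-toList i)

-- This is the exponent of `Y` in `Y ^ (n - 1) * Y ^ x`. For `n = 0` the right side would be `x`,
-- whereas the left side can be smaller, because the deficit hidden by the truncation is still
-- subtracted there.
height-full-∷ʳ : (i : Vec ℕ k) (x : ℕ) → height i k ≢ 0 →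
                 height (i ∷ʳ x) (suc k) ≡ ℕ.pred (height i k) ℕ.+ x
height-full-∷ʳ {k} i x h≢0 = begin
  height (i ∷ʳ x) (suc k)            ≡⟨ height-full (i ∷ʳ x) ⟩
  Vec.sum (i ∷ʳ x) ∸ k               ≡⟨ cong (_∸ k) (sum-∷ʳ i x) ⟩
  Vec.sum i ℕ.+ x ∸ k                ≡⟨ ℕ.+-∸-comm x k≤sum ⟩
  Vec.sum i ∸ k ℕ.+ x                ≡⟨ cong (λ n → ℕ.pred n ℕ.+ x) (ℕ.+-∸-assoc 1 k≤sum) ⟨
  ℕ.pred (suc (Vec.sum i) ∸ k) ℕ.+ x ≡⟨ cong (λ n → ℕ.pred n ℕ.+ x) (height-full i) ⟨
  ℕ.pred (height i k) ℕ.+ x          ∎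
  where
  open ≡.≡-Reasoning
  k≤sum : k ≤ Vec.sum i
  k≤sum = ℕ.s≤s⁻¹ (ℕ.m∸n≢0⇒n<m {suc (Vec.sum i)} (h≢0 ∘ ≡.trans (height-full i)))

sum-take≤ : (j : ℕ) (i : Vec ℕ k) → sum (List.take j (Vec.toList i)) ≤ Vec.sum i
sum-take≤ zero    i       = z≤n
sum-take≤ (suc j) []      = z≤n
sum-take≤ (suc j) (x ∷ i) = ℕ.+-monoʳ-≤ x (sum-take≤ j i)

-- If the untruncated exponent is negative, the last factor [ i₁ + ⋯ + iₑ + 1 - e ] vanishes.
height-vanishes : ∀ {e} (i : Vec ℕ (suc e)) → suc (Vec.sum i) ℕ.< suc e → height i e ≡ 0
height-vanishes {e} i lt = ℕ.m≤n⇒m∸n≡0 (ℕ.≤-trans (s≤s (sum-take≤ e i)) (ℕ.s≤s⁻¹ lt))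

-- Finite sums and products, and sums along antidiagonals.

module SumProperties (R : Ring a ℓ) where
  open Ring R hiding (zero)
  open RingOps R
  open CommutativeSemigroup (CommutativeMonoid.commutativeSemigroup +-commutativeMonoid)
    using (interchange)
  open SetoidReasoning setoid

  sum-cong : ∀ (xs : List B) {F G : B → Carrier} → (∀ x → F x ≈ G x) → sumOver xs F ≈ sumOver xs G
  sum-cong []       F≈G = refl
  sum-cong (x ∷ xs) F≈G = +-cong (F≈G x) (sum-cong xs F≈G)

  sum-++ : ∀ (xs ys : List B) (F : B → Carrier) → sumOver (xs ++ ys) F ≈ sumOver xs F + sumOver ys F
  sum-++ []       ys F = sym (+-identityˡ _)
  sum-++ (x ∷ xs) ys F = trans (+-congˡ (sum-++ xs ys F)) (sym (+-assoc _ _ _))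

  sum-map : ∀ (f : B′ → B) (xs : List B′) (F : B → Carrier) →
            sumOver (List.map f xs) F ≈ sumOver xs (F ∘ f)
  sum-map f []       F = refl
  sum-map f (x ∷ xs) F = +-congˡ (sum-map f xs F)

  sum-↭ : ∀ {xs ys : List B} (F : B → Carrier) → xs ↭ ys → sumOver xs F ≈ sumOver ys F
  sum-↭ F Perm.refl          = refl
  sum-↭ F (Perm.prep x p)    = +-congˡ (sum-↭ F p)
  sum-↭ F (Perm.trans p q)   = trans (sum-↭ F p) (sum-↭ F q)
  sum-↭ {xs = x ∷ y ∷ xs} {ys = _ ∷ _ ∷ ys} F (Perm.swap x y p) = begin
    F x + (F y + sumOver xs F)  ≈⟨ +-assoc _ _ _ ⟨
    F x + F y + sumOver xs F    ≈⟨ +-cong (+-comm _ _) (sum-↭ F p) ⟩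
    F y + F x + sumOver ys F    ≈⟨ +-assoc _ _ _ ⟩
    F y + (F x + sumOver ys F)  ∎

  sum-+ : ∀ (xs : List B) (F G : B → Carrier) →
          sumOver xs (λ x → F x + G x) ≈ sumOver xs F + sumOver xs G
  sum-+ []       F G = sym (+-identityˡ _)
  sum-+ (x ∷ xs) F G = trans (+-congˡ (sum-+ xs F G)) (interchange _ _ _ _)

  *-distribˡ-sum : ∀ y (xs : List B) (F : B → Carrier) →
                   y * sumOver xs F ≈ sumOver xs (λ x → y * F x)
  *-distribˡ-sum y []       F = zeroʳ y
  *-distribˡ-sum y (x ∷ xs) F = trans (distribˡ y _ _) (+-congˡ (*-distribˡ-sum y xs F))

  *-distribʳ-sum : ∀ y (xs : List B) (F : B → Carrier) →
                   sumOver xs F * y ≈ sumOver xs (λ x → F x * y)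
  *-distribʳ-sum y []       F = zeroˡ y
  *-distribʳ-sum y (x ∷ xs) F = trans (distribʳ y _ _) (+-congˡ (*-distribʳ-sum y xs F))

  sum-cartesianProductWith : ∀ {C : Set b} (f : B → B′ → C) xs ys (F : C → Carrier) →
    sumOver (List.cartesianProductWith f xs ys) F ≈ ∑[ x ← xs ] ∑[ y ← ys ] F (f x y)
  sum-cartesianProductWith f []       ys F = refl
  sum-cartesianProductWith f (x ∷ xs) ys F = trans
    (sum-++ (List.map (f x) ys) _ F)
    (+-cong (sum-map (f x) ys F) (sum-cartesianProductWith f xs ys F))

  -- `tuples` grows at the front, but a new index belongs at the back. Lexicographic order is the
  -- same either way, so no summands have to be exchanged.
  sum-tuples-∷ʳ : ∀ (xs : List B) k (F : Vec B (suc k) → Carrier) →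
    sumOver (tuples xs (suc k)) F ≈ ∑[ t ← tuples xs k ] ∑[ x ← xs ] F (t ∷ʳ x)
  sum-tuples-∷ʳ xs zero F = begin
    sumOver (tuples xs 1) F                    ≈⟨ sum-cartesianProductWith _∷_ xs ([] ∷ []) F ⟩
    (∑[ x ← xs ] (F (x ∷ []) + 0#))            ≈⟨ sum-cong xs (λ x → +-identityʳ _) ⟩
    (∑[ x ← xs ] F (x ∷ []))                   ≈⟨ +-identityʳ _ ⟨
    (∑[ x ← xs ] F (x ∷ [])) + 0#              ∎
  sum-tuples-∷ʳ xs (suc k) F = begin
    sumOver (tuples xs (suc (suc k))) F
      ≈⟨ sum-cartesianProductWith _∷_ xs (tuples xs (suc k)) F ⟩
    (∑[ x ← xs ] ∑[ t ← tuples xs (suc k) ] F (x ∷ t))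
      ≈⟨ sum-cong xs (λ x → sum-tuples-∷ʳ xs k (F ∘ (x ∷_))) ⟩
    (∑[ x ← xs ] ∑[ t ← tuples xs k ] ∑[ y ← xs ] F (x ∷ (t ∷ʳ y)))
      ≈⟨ sum-cartesianProductWith _∷_ xs (tuples xs k) _ ⟨
    (∑[ t ← tuples xs (suc k) ] ∑[ y ← xs ] F (t ∷ʳ y)) ∎

  prod-∷ʳ : ∀ (t : Vec B k) x (F : B → Carrier) →
            prodOver (Vec.toList (t ∷ʳ x)) F ≈ prodOver (Vec.toList t) F * F x
  prod-∷ʳ []      x F = trans (*-identityʳ _) (sym (*-identityˡ _))
  prod-∷ʳ (y ∷ t) x F = trans (*-congˡ (prod-∷ʳ t x F)) (sym (*-assoc _ _ _))

  prod-applyUpTo-suc : ∀ (f : ℕ → B) n (F : B → Carrier) →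
    prodOver (applyUpTo f (suc n)) F ≈ prodOver (applyUpTo f n) F * F (f n)
  prod-applyUpTo-suc f zero    F = trans (*-identityʳ _) (sym (*-identityˡ _))
  prod-applyUpTo-suc f (suc n) F =
    trans (*-congˡ (prod-applyUpTo-suc (f ∘ suc) n F)) (sym (*-assoc _ _ _))

  prod-applyUpTo-cong : ∀ (f : ℕ → B) n {F G : B → Carrier} →
    (∀ {i} → i ℕ.< n → F (f i) ≈ G (f i)) →
    prodOver (applyUpTo f n) F ≈ prodOver (applyUpTo f n) G
  prod-applyUpTo-cong f zero    F≈G = refl
  prod-applyUpTo-cong f (suc n) F≈G =
    *-cong (F≈G (s≤s z≤n)) (prod-applyUpTo-cong (f ∘ suc) n (F≈G ∘ s≤s))

  -- The sum of `F` over `(w , j)`, `(w - 1 , suc j)`, ..., `(0 , j + w)`. Recursion on both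
  -- coordinates avoids the subtraction `m ∸ j`, so that neighbouring antidiagonals can be compared
  -- by structural induction.
  antidiagonal : (ℕ → ℕ → Carrier) → ℕ → ℕ → Carrier
  antidiagonal F zero    j = F zero j
  antidiagonal F (suc w) j = F (suc w) j + antidiagonal F w (suc j)

  -- `upTo` is `applyUpTo id`, and its tail is an `applyUpTo` of a shifted function; the induction
  -- therefore runs over all `f` of the form `j + i`.
  sum-antidiagonal : ∀ (F : ℕ → ℕ → Carrier) w j (f : ℕ → ℕ) → (∀ i → f i ≡ j ℕ.+ i) →
    sumOver (applyUpTo f (suc w)) (λ i → F (j ℕ.+ w ∸ i) i) ≈ antidiagonal F w j
  sum-antidiagonal F zero j f f≡
    rewrite ≡.trans (f≡ 0) (ℕ.+-identityʳ j) | ℕ.m+n∸m≡n j 0 = +-identityʳ _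
  sum-antidiagonal F (suc w) j f f≡ = +-cong head≈ (begin
    sumOver js (λ i → F (j ℕ.+ suc w ∸ i) i)
      ≈⟨ sum-cong js (λ i → reflexive (cong (λ n → F (n ∸ i) i) (ℕ.+-suc j w))) ⟩
    sumOver js (λ i → F (suc j ℕ.+ w ∸ i) i)
      ≈⟨ sum-antidiagonal F w (suc j) (f ∘ suc) (λ i → ≡.trans (f≡ (suc i)) (ℕ.+-suc j i)) ⟩
    antidiagonal F w (suc j) ∎)
    where
    js = applyUpTo (f ∘ suc) (suc w)
    head≈ : F (j ℕ.+ suc w ∸ f 0) (f 0) ≈ F (suc w) j
    head≈ rewrite ≡.trans (f≡ 0) (ℕ.+-identityʳ j) | ℕ.m+n∸m≡n j (suc w) = refl

  -- A regrouping as in Pascal's triangle: `P w j` belongs to the position `(suc w , j)` and `R w j`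
  -- to `(w , suc j)`. An interior position of the next antidiagonal receives one of each, the end
  -- with first coordinate 0 only an `R`, and the starting corner only a `P`, which is left as a
  -- separate summand.
  antidiagonal-shift : ∀ (P R T : ℕ → ℕ → Carrier) →
    (∀ j → T 0 (suc j) ≈ R 0 j) →
    (∀ w j → T (suc w) (suc j) ≈ P w (suc j) + R (suc w) j) →
    ∀ w j → antidiagonal (λ w j → P w j + R w j) w j ≈ P w j + antidiagonal T w (suc j)
  antidiagonal-shift P R T T₀ T₁ zero    j = +-congˡ (sym (T₀ j))
  antidiagonal-shift P R T T₀ T₁ (suc w) j = begin
    P (suc w) j + R (suc w) j + antidiagonal (λ w j → P w j + R w j) w (suc j)
      ≈⟨ +-congˡ (antidiagonal-shift P R T T₀ T₁ w (suc j)) ⟩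
    P (suc w) j + R (suc w) j + (P w (suc j) + antidiagonal T w (suc (suc j)))
      ≈⟨ +-assoc _ _ _ ⟩
    P (suc w) j + (R (suc w) j + (P w (suc j) + antidiagonal T w (suc (suc j))))
      ≈⟨ +-congˡ (+-assoc _ _ _) ⟨
    P (suc w) j + (R (suc w) j + P w (suc j) + antidiagonal T w (suc (suc j)))
      ≈⟨ +-congˡ (+-congʳ (trans (+-comm _ _) (sym (T₁ w j)))) ⟩
    P (suc w) j + (T (suc w) (suc j) + antidiagonal T w (suc (suc j))) ∎

  *-antidiagonal : ∀ y {F G : ℕ → ℕ → Carrier} → (∀ w j → y * F w j ≈ G w j) →
                   ∀ w j → y * antidiagonal F w j ≈ antidiagonal G w j
  *-antidiagonal y yF≈G zero    j = yF≈G zero j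
  *-antidiagonal y yF≈G (suc w) j =
    trans (distribˡ y _ _) (+-cong (yF≈G (suc w) j) (*-antidiagonal y yF≈G w (suc j)))

-- Scalars: the numbers `[ n ]` and the coefficients of `g`.

module ScalarProperties {c ℓ} (S : PQScalars c ℓ) where
  open PQScalars S hiding (zero)
  open SumProperties ring
  open Exp semiring using (^-homo-*; ^-congʳ)
  open CommutativeExp commutativeSemiring using (^-distrib-*)
  open CommutativeMonoidSolver *-commutativeMonoid using (solve; _⊜_; _⊕_)
  open RingProperties ring using (x[y-z]≈xy-xz)
  open SetoidReasoning setoid

  [0] : [ 0 ]pq ≈ 0#
  [0] = trans (*-congʳ (-‿inverseʳ 1#)) (zeroˡ _)

  [1] : [ 1 ]pq ≈ 1#
  [1] = trans (*-congʳ (+-cong (*-identityʳ p) (-‿cong (*-identityʳ q)))) (proj₂ (proj₂ p-q-unit))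

  -- Of the two symmetric recursions this is the one met in `X*Y^`: the factor `q` comes from moving
  -- `X` past one `Y`, and `p ^ n` from moving `Z` past the other `n`.
  [suc] : ∀ n → [ suc n ]pq ≈ q * [ n ]pq + p ^ n
  [suc] n = begin
    (p * p ^ n - q * q ^ n) * u
      ≈⟨ *-congʳ telescope ⟩
    (q * (p ^ n - q ^ n) + p ^ n * (p - q)) * u
      ≈⟨ distribʳ u _ _ ⟩
    q * (p ^ n - q ^ n) * u + p ^ n * (p - q) * u
      ≈⟨ +-cong (*-assoc _ _ _)
           (trans (*-assoc _ _ _) (trans (*-congˡ (proj₂ (proj₂ p-q-unit))) (*-identityʳ _))) ⟩
    q * [ n ]pq + p ^ n ∎
    where
    u = proj₁ p-q-unit
    telescope : p * p ^ n - q * q ^ n ≈ q * (p ^ n - q ^ n) + p ^ n * (p - q)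
    telescope = begin
      p * p ^ n - q * q ^ n
        ≈⟨ +-congʳ (+-identityʳ _) ⟨
      p * p ^ n + 0# - q * q ^ n
        ≈⟨ +-congʳ (+-congˡ (-‿inverseˡ (q * p ^ n))) ⟨
      p * p ^ n + (- (q * p ^ n) + q * p ^ n) - q * q ^ n
        ≈⟨ +-congʳ (+-assoc _ _ _) ⟨
      p * p ^ n - q * p ^ n + q * p ^ n - q * q ^ n
        ≈⟨ +-assoc _ _ _ ⟩
      p * p ^ n - q * p ^ n + (q * p ^ n - q * q ^ n)
        ≈⟨ +-comm _ _ ⟩
      q * p ^ n - q * q ^ n + (p * p ^ n - q * p ^ n)
        ≈⟨ +-cong (x[y-z]≈xy-xz q _ _) (+-cong (*-comm _ _) (-‿cong (*-comm _ _))) ⟨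
      q * (p ^ n - q ^ n) + (p ^ n * p - p ^ n * q)
        ≈⟨ +-congˡ (x[y-z]≈xy-xz (p ^ n) p q) ⟨
      q * (p ^ n - q ^ n) + p ^ n * (p - q) ∎

  q⁻¹ : Carrier
  q⁻¹ = proj₁ q-unit

  1^ : ∀ n → 1# ^ n ≈ 1#
  1^ zero    = refl
  1^ (suc n) = trans (*-identityˡ _) (1^ n)

  q^*q⁻¹^ : ∀ n → q ^ n * q⁻¹ ^ n ≈ 1#
  q^*q⁻¹^ n = begin
    q ^ n * q⁻¹ ^ n  ≈⟨ ^-distrib-* q q⁻¹ n ⟨
    (q * q⁻¹) ^ n    ≈⟨ Exp.^-congˡ semiring n (proj₂ (proj₂ q-unit)) ⟩
    1# ^ n           ≈⟨ 1^ n ⟩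
    1#               ∎

  -- Common successors in `m ⊖ n` cancel as `q * q⁻¹` does. With this form no later computation has
  -- to distinguish the sign of the exponent.
  q^ᶻ-⊖ : ∀ m n → q^ᶻ (m ⊖ n) ≈ q ^ m * q⁻¹ ^ n
  q^ᶻ-⊖ m       zero    = sym (*-identityʳ _)
  q^ᶻ-⊖ zero    (suc n) = sym (*-identityˡ _)
  q^ᶻ-⊖ (suc m) (suc n) = begin
    q^ᶻ (suc m ⊖ suc n)            ≡⟨ cong q^ᶻ (ℤ.[1+m]⊖[1+n]≡m⊖n m n) ⟩
    q^ᶻ (m ⊖ n)                    ≈⟨ q^ᶻ-⊖ m n ⟩
    q ^ m * q⁻¹ ^ n                ≈⟨ *-identityˡ _ ⟨
    1# * (q ^ m * q⁻¹ ^ n)         ≈⟨ *-congʳ (proj₂ (proj₂ q-unit)) ⟨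
    q * q⁻¹ * (q ^ m * q⁻¹ ^ n)
      ≈⟨ solve 4 (λ a b c d → ((a ⊕ b) ⊕ (c ⊕ d)) ⊜ ((a ⊕ c) ⊕ (b ⊕ d))) refl _ _ _ _ ⟩
    q ^ suc m * q⁻¹ ^ suc n        ∎

  weight : ∀ {k} → ℕ → Vec ℕ k → Carrier
  weight w l = q^ᶻ (w ⊖ ∣ l ∣) * p ^ ∣ l ∣

  weight-∷ʳ0 : ∀ {k} w (l : Vec ℕ k) → weight w (l ∷ʳ 0) ≈ weight w l
  weight-∷ʳ0 w l = reflexive
    (cong (λ n → q^ᶻ (w ⊖ n) * p ^ n) (≡.trans (sum-∷ʳ l 0) (ℕ.+-identityʳ _)))

  module Coefficients (s : ℕ) (α : Fin (suc s) → Carrier) where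

    -- `ℕ.pred` makes the product empty for `d = 0` as well as for `d = 1`. A factor for `j = 0`
    -- would be `[ 1 ]`, so the two agree with the general recursion in `heightProduct-∷ʳ`.
    heightProduct : ∀ {d} → Vec ℕ d → Carrier
    heightProduct {d} i = prodOver (applyUpTo suc (ℕ.pred d)) (λ j → [ height i j ]pq)

    coeff : ∀ {d} → Vec ℕ d → Vec (Fin (suc s)) d → Carrier
    coeff l t = q ^ Vec.sum (Vec.zipWith ℕ._*_ i l) * prodOver (Vec.toList t) α * heightProduct i
      where i = Vec.map toℕ t

    heightProduct-∷ʳ : ∀ {d} (i : Vec ℕ d) x →
                       heightProduct (i ∷ʳ x) ≈ heightProduct i * [ height i d ]pq
    heightProduct-∷ʳ {zero}  [] x = sym (trans (*-identityˡ _) [1])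
    heightProduct-∷ʳ {suc e} i  x = trans
      (prod-applyUpTo-cong suc (suc e) (λ j<d → reflexive (cong [_]pq (height-∷ʳ i x j<d))))
      (prod-applyUpTo-suc suc e _)

    -- It makes truncation harmless: tuples with a negative true exponent have coefficient zero.
    heightProduct≈0 : ∀ {d} (i : Vec ℕ d) → suc (Vec.sum i) ℕ.< d → heightProduct i ≈ 0#
    heightProduct≈0 {suc zero}    i (s≤s ())
    heightProduct≈0 {suc (suc e)} i lt = begin
      heightProduct i
        ≈⟨ prod-applyUpTo-suc suc e _ ⟩
      prodOver (applyUpTo suc e) (λ j → [ height i j ]pq) * [ height i (suc e) ]pq
        ≡⟨ cong (λ n → prodOver (applyUpTo suc e) (λ j → [ height i j ]pq) * [ n ]pq)
             (height-vanishes i lt) ⟩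
      prodOver (applyUpTo suc e) (λ j → [ height i j ]pq) * [ 0 ]pq
        ≈⟨ trans (*-congˡ [0]) (zeroʳ _) ⟩
      0# ∎

    -- The new index is multiplied by the part 0, so the power of `q` does not change.
    coeff-∷ʳ0 : ∀ {d} (l : Vec ℕ d) t x →
      coeff (l ∷ʳ 0) (t ∷ʳ x) ≈ coeff l t * [ height (Vec.map toℕ t) d ]pq * α x
    coeff-∷ʳ0 {d} l t x rewrite Vec.map-∷ʳ toℕ x t = begin
      q ^ Vec.sum (Vec.zipWith ℕ._*_ (i ∷ʳ toℕ x) (l ∷ʳ 0)) * prodOver (Vec.toList (t ∷ʳ x)) α
        * heightProduct (i ∷ʳ toℕ x)
        ≈⟨ *-cong (*-cong (^-congʳ q (sum-zipWith-*-∷ʳ0 i l (toℕ x))) (prod-∷ʳ t x α))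
                 (heightProduct-∷ʳ i (toℕ x)) ⟩
      q ^ Vec.sum (Vec.zipWith ℕ._*_ i l) * (prodOver (Vec.toList t) α * α x)
        * (heightProduct i * [ height i d ]pq)
        ≈⟨ solve 5 (λ a b c e f → ((a ⊕ (b ⊕ c)) ⊕ (e ⊕ f)) ⊜ ((((a ⊕ b) ⊕ e) ⊕ f) ⊕ c))
             refl _ _ _ _ _ ⟩
      coeff l t * [ height i d ]pq * α x ∎
      where i = Vec.map toℕ t

    -- When every part grows by 1, the exponent of `q` gains 1 from `suc w`, loses `d` through
    -- `∣ l ∣` and gains the sum of the indices through the products of indices and parts. The total
    -- is the untruncated height, and the exponent of `p` gains `d`.
    coeff-map-suc : ∀ {d} w (l : Vec ℕ d) t →
      weight w l * coeff l t * (q ^ height (Vec.map toℕ t) d * p ^ d)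
        ≈ weight (suc w) (Vec.map suc l) * coeff (Vec.map suc l) t
    coeff-map-suc {d} w l t with d ℕ.≤? suc (Vec.sum (Vec.map toℕ t))
    -- Here the height is truncated and the exponents of `q` do not balance, but both coefficients
    -- vanish.
    ... | no d≰ = trans
      (*-congʳ (trans (*-congˡ (vanish l)) (zeroʳ _)))
      (trans (zeroˡ _) (sym (trans (*-congˡ (vanish (Vec.map suc l))) (zeroʳ _))))
      where
      vanish : ∀ l → coeff l t ≈ 0#
      vanish l = trans (*-congˡ (heightProduct≈0 (Vec.map toℕ t) (ℕ.≰⇒> d≰))) (zeroʳ _)
    ... | yes d≤ = begin
      weight w l * coeff l t * (q ^ N * p ^ d)
        ≈⟨ *-congʳ (*-congʳ (*-congʳ (q^ᶻ-⊖ w ∣ l ∣))) ⟩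
      q ^ w * q⁻¹ ^ ∣ l ∣ * p ^ ∣ l ∣ * (q ^ Q * A * H) * (q ^ N * p ^ d)
        ≈⟨ *-identityʳ _ ⟨
      q ^ w * q⁻¹ ^ ∣ l ∣ * p ^ ∣ l ∣ * (q ^ Q * A * H) * (q ^ N * p ^ d) * 1#
        -- The inserted `q ^ d` completes `q ^ N` to `q ^ suc σ`, and `q⁻¹ ^ d` accounts for the
        -- growth of `∣ l ∣`.
        ≈⟨ *-congˡ (q^*q⁻¹^ d) ⟨
      q ^ w * q⁻¹ ^ ∣ l ∣ * p ^ ∣ l ∣ * (q ^ Q * A * H) * (q ^ N * p ^ d) * (q ^ d * q⁻¹ ^ d)
        ≈⟨ solve 10 (λ qw vl pl qQ A H qN pd qd vd →
             (((((qw ⊕ vl) ⊕ pl) ⊕ ((qQ ⊕ A) ⊕ H)) ⊕ (qN ⊕ pd)) ⊕ (qd ⊕ vd))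
             ⊜ ((qw ⊕ (qN ⊕ qd)) ⊕ (((vd ⊕ vl) ⊕ (pd ⊕ pl)) ⊕ ((qQ ⊕ A) ⊕ H))))
             refl _ _ _ _ _ _ _ _ _ _ ⟩
      q ^ w * (q ^ N * q ^ d) * ((q⁻¹ ^ d * q⁻¹ ^ ∣ l ∣) * (p ^ d * p ^ ∣ l ∣) * (q ^ Q * A * H))
        ≈⟨ *-cong (*-congˡ q^N*q^d) (*-congʳ (*-cong (sym (pow q⁻¹)) (sym (pow p)))) ⟩
      q ^ w * (q * q ^ σ) * (q⁻¹ ^ ∣ Vec.map suc l ∣ * p ^ ∣ Vec.map suc l ∣ * (q ^ Q * A * H))
        ≈⟨ solve 8 (λ qw q qσ v p qQ A H → ((qw ⊕ (q ⊕ qσ)) ⊕ ((v ⊕ p) ⊕ ((qQ ⊕ A) ⊕ H)))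
             ⊜ ((((q ⊕ qw) ⊕ v) ⊕ p) ⊕ (((qσ ⊕ qQ) ⊕ A) ⊕ H))) refl _ _ _ _ _ _ _ _ ⟩
      q ^ suc w * q⁻¹ ^ ∣ Vec.map suc l ∣ * p ^ ∣ Vec.map suc l ∣ * (q ^ σ * q ^ Q * A * H)
        ≈⟨ *-cong (*-congʳ (q^ᶻ-⊖ (suc w) ∣ Vec.map suc l ∣))
                 (*-congʳ (*-congʳ (trans (^-congʳ q (sum-zipWith-*-suc i l)) (^-homo-* q σ Q)))) ⟨
      weight (suc w) (Vec.map suc l) * coeff (Vec.map suc l) t ∎
      where
      i = Vec.map toℕ t
      N = height i d
      σ = Vec.sum i
      Q = Vec.sum (Vec.zipWith ℕ._*_ i l)
      A = prodOver (Vec.toList t) α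
      H = heightProduct i
      q^N*q^d : q ^ N * q ^ d ≈ q ^ suc σ
      q^N*q^d = trans (sym (^-homo-* q N d))
        (^-congʳ q (≡.trans (cong (ℕ._+ d) (height-full i)) (ℕ.m∸n+n≡m d≤)))
      pow : ∀ x → x ^ ∣ Vec.map suc l ∣ ≈ x ^ d * x ^ ∣ l ∣
      pow x = trans (^-congʳ x (sum-map-suc l)) (^-homo-* x d ∣ l ∣)

-- Scalars acting on the algebra, and closure properties of normal ordered elements.

module ScalarAction {c ℓ a ℓ′} (S : PQScalars c ℓ)
  (𝒜 : UnitalAlgebra (PQScalars.commutativeRing S) a ℓ′) where
  private module K = PQScalars S
  open UnitalAlgebra 𝒜 hiding (zero)
  open RingOps ring
  open NormalOrdering S 𝒜
  open SumProperties ring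
  open RingMorphisms.IsRingHomomorphism ι-isRingHomomorphism
  open SetoidReasoning setoid

  •-congʳ : ∀ {k l x} → k K.≈ l → k • x ≈ l • x
  •-congʳ k≈l = *-congʳ (⟦⟧-cong k≈l)

  •-assoc : ∀ k l x → (k K.* l) • x ≈ k • l • x
  •-assoc k l x = trans (*-congʳ (*-homo k l)) (*-assoc _ _ _)

  •-comm : ∀ k l x → k • l • x ≈ l • k • x
  •-comm k l x = trans (sym (•-assoc k l x)) (trans (•-congʳ (K.*-comm k l)) (•-assoc l k x))

  *-• : ∀ x k y → x * (k • y) ≈ k • (x * y)
  *-• x k y = trans (sym (*-assoc x _ y)) (trans (*-congʳ (sym (ι-central k x))) (*-assoc _ _ _))

  •-identityˡ : ∀ x → K.1# • x ≈ x
  •-identityˡ x = trans (*-congʳ 1#-homo) (*-identityˡ x)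

  •-zero : ∀ {k} x → k K.≈ K.0# → k • x ≈ 0#
  •-zero x k≈0 = trans (•-congʳ k≈0) (trans (*-congʳ 0#-homo) (zeroˡ x))

  •-distribʳ : ∀ k l x → (k K.+ l) • x ≈ k • x + l • x
  •-distribʳ k l x = trans (*-congʳ (+-homo k l)) (distribʳ x _ _)

  ^-*-comm : ∀ x y → x * y ≈ y * x → ∀ n → x * y ^ n ≈ y ^ n * x
  ^-*-comm x y xy≈yx zero    = trans (*-identityʳ x) (sym (*-identityˡ x))
  ^-*-comm x y xy≈yx (suc n) = begin
    x * (y * y ^ n)  ≈⟨ *-assoc _ _ _ ⟨
    x * y * y ^ n    ≈⟨ *-congʳ xy≈yx ⟩
    y * x * y ^ n    ≈⟨ *-assoc _ _ _ ⟩
    y * (x * y ^ n)  ≈⟨ *-congˡ (^-*-comm x y xy≈yx n) ⟩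
    y * (y ^ n * x)  ≈⟨ *-assoc _ _ _ ⟨
    y * y ^ n * x    ∎

  ^-q-comm : ∀ {k} x y → x * y ≈ k • (y * x) → ∀ n → x * y ^ n ≈ (k K.^ n) • (y ^ n * x)
  ^-q-comm x y xy≈kyx zero = trans (*-identityʳ x) (sym (trans (•-identityˡ _) (*-identityˡ x)))
  ^-q-comm {k} x y xy≈kyx (suc n) = begin
    x * (y * y ^ n)                       ≈⟨ *-assoc _ _ _ ⟨
    x * y * y ^ n                         ≈⟨ *-congʳ xy≈kyx ⟩
    (k • (y * x)) * y ^ n                 ≈⟨ *-assoc _ _ _ ⟩
    k • (y * x * y ^ n)                   ≈⟨ *-congˡ (*-assoc _ _ _) ⟩
    k • (y * (x * y ^ n))                 ≈⟨ *-congˡ (*-congˡ (^-q-comm x y xy≈kyx n)) ⟩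
    k • (y * ((k K.^ n) • (y ^ n * x)))   ≈⟨ *-congˡ (*-• _ _ _) ⟩
    k • (k K.^ n) • (y * (y ^ n * x))     ≈⟨ •-assoc _ _ _ ⟨
    (k K.^ suc n) • (y * (y ^ n * x))     ≈⟨ *-congˡ (*-assoc _ _ _) ⟨
    (k K.^ suc n) • (y ^ suc n * x)       ∎

  module NormalOrderedProperties (X Y Z : Carrier) where
    private
      NO : Carrier → Set _
      NO = NormalOrdered X Y Z

    NO-resp-≈ : ∀ {x y} → x ≈ y → NO x → NO y
    NO-resp-≈ x≈y (ts , x≈) = ts , trans (sym x≈y) x≈

    NO-monomial : ∀ k u v w → NO (k • (Y ^ u * Z ^ v * X ^ w))
    NO-monomial k u v w = (k , u , v , w) ∷ [] , sym (+-identityʳ _)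

    NO-+ : ∀ {x y} → NO x → NO y → NO (x + y)
    NO-+ (ts , x≈) (us , y≈) = ts ++ us , trans (+-cong x≈ y≈) (sym (sum-++ ts us _))

    NO-sum : ∀ {b} {B : Set b} (xs : List B) {F : B → Carrier} → (∀ x → NO (F x)) → NO (sumOver xs F)
    NO-sum []       F! = [] , refl
    NO-sum (x ∷ xs) F! = NO-+ (F! x) (NO-sum xs F!)

    NO-• : ∀ k {x} → NO x → NO (k • x)
    NO-• k {x} (ts , x≈) = List.map (λ (l , m) → k K.* l , m) ts , (begin
      k • x                                        ≈⟨ *-congˡ x≈ ⟩
      k • sumOver ts _                             ≈⟨ *-distribˡ-sum (ι k) ts _ ⟩
      sumOver ts _                                 ≈⟨ sum-cong ts (λ (l , _) → •-assoc k l _) ⟨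
      sumOver ts _                                 ≈⟨ sum-map _ ts _ ⟨
      sumOver (List.map _ ts) _                    ∎)

-- Moving `X` to the right, and the induction on `m`.

module Commutation {c ℓ a ℓ′} (S : PQScalars c ℓ)
  (𝒜 : UnitalAlgebra (PQScalars.commutativeRing S) a ℓ′)
  (h : PQScalars.Carrier S) (s : ℕ) (α : Fin (suc s) → PQScalars.Carrier S) where
  private module K = PQScalars S
  open K using (p; q; [_]pq)
  open UnitalAlgebra 𝒜 hiding (zero)
  open RingOps ring
  open NormalOrdering S 𝒜
  open SumProperties ring
  open Exp semiring using (^-homo-*; ^-congʳ)
  open ScalarAction S 𝒜
  open ScalarProperties S
  open Coefficients s α
  open SetoidReasoning setoid

  module _ (X Y Z : Carrier)
    (XY : X * Y - q • (Y * X) ≈ h • (poly s α Y * Z))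
    (ZY : Z * Y ≈ p • (Y * Z))
    (XZ : X * Z ≈ p • (Z * X)) where
    open NormalOrderedProperties X Y Z

    f : Carrier
    f = poly s α Y

    XY′ : X * Y ≈ q • (Y * X) + h • (f * Z)
    XY′ = begin
      X * Y                                      ≈⟨ +-identityʳ _ ⟨
      X * Y + 0#                                 ≈⟨ +-congˡ (-‿inverseˡ _) ⟨
      X * Y + (- (q • (Y * X)) + q • (Y * X))    ≈⟨ +-assoc _ _ _ ⟨
      X * Y - q • (Y * X) + q • (Y * X)          ≈⟨ +-comm _ _ ⟩
      q • (Y * X) + (X * Y - q • (Y * X))        ≈⟨ +-congˡ XY ⟩
      q • (Y * X) + h • (f * Z)                  ∎

    fY : f * Y ≈ Y * f
    fY = begin
      f * Y                                               ≈⟨ *-distribʳ-sum Y js _ ⟩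
      (∑[ j ← js ] (α j • Y ^ toℕ j) * Y)                 ≈⟨ sum-cong js (λ j → trans (*-assoc _ _ _)
        (trans (*-congˡ (sym (^-*-comm Y Y refl (toℕ j)))) (sym (*-• _ _ _)))) ⟩
      (∑[ j ← js ] Y * (α j • Y ^ toℕ j))                 ≈⟨ *-distribˡ-sum Y js _ ⟨
      Y * f                                               ∎
      where js = allFin (suc s)

    -- [ 0 ] = 0 absorbs the truncation of n - 1 at n = 0.
    Y*Y^pred : ∀ n e → [ n ]pq • (Y * (Y ^ ℕ.pred n * e)) ≈ [ n ]pq • (Y ^ n * e)
    Y*Y^pred zero    e = trans (•-zero _ [0]) (sym (•-zero _ [0]))
    Y*Y^pred (suc n) e = *-congˡ (sym (*-assoc _ _ _))

    -- Crossing the first `Y` leaves `f * Z` in front of the remaining `Y ^ n`. Moving `Z` across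
    -- gives `p ^ n`, and `f` commutes with `Y`; so this term is a multiple of the same element as
    -- `q` times the inductive one, and the coefficients add up by `[suc]`.
    X*Y^ : ∀ n → X * Y ^ n ≈ (q K.^ n) • (Y ^ n * X) + h • [ n ]pq • (Y ^ ℕ.pred n * f * Z)
    X*Y^ zero = begin
      X * 1#                                              ≈⟨ *-identityʳ X ⟩
      X                                                   ≈⟨ trans (•-identityˡ _) (*-identityˡ X) ⟨
      K.1# • (1# * X)                                     ≈⟨ +-identityʳ _ ⟨
      K.1# • (1# * X) + 0#
        ≈⟨ +-congˡ (trans (*-congˡ (•-zero _ [0])) (zeroʳ _)) ⟨
      K.1# • (1# * X) + h • [ 0 ]pq • (1# * f * Z)        ∎
    X*Y^ (suc n) = begin
      X * (Y * Y ^ n)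
        ≈⟨ *-assoc _ _ _ ⟨
      X * Y * Y ^ n
        ≈⟨ *-congʳ XY′ ⟩
      (q • (Y * X) + h • (f * Z)) * Y ^ n
        ≈⟨ distribʳ _ _ _ ⟩
      (q • (Y * X)) * Y ^ n + (h • (f * Z)) * Y ^ n
        ≈⟨ +-cong (trans (*-assoc _ _ _) (*-congˡ (*-assoc _ _ _)))
                  (trans (*-assoc _ _ _) (*-congˡ (*-assoc _ _ _))) ⟩
      q • (Y * (X * Y ^ n)) + h • (f * (Z * Y ^ n))
        ≈⟨ +-cong (trans (*-congˡ (trans (*-congˡ (X*Y^ n)) (distribˡ _ _ _))) (distribˡ _ _ _))
                  (*-congˡ last) ⟩
      q • (Y * ((q K.^ n) • (Y ^ n * X))) + q • (Y * (h • [ n ]pq • (Y ^ ℕ.pred n * f * Z)))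
        + h • (p K.^ n) • (Y ^ n * f * Z)
        ≈⟨ +-congʳ (+-cong first middle) ⟩
      (q K.^ suc n) • (Y ^ suc n * X) + h • (q K.* [ n ]pq) • (Y ^ n * f * Z)
        + h • (p K.^ n) • (Y ^ n * f * Z)
        ≈⟨ trans (+-assoc _ _ _)
             (+-congˡ (trans (sym (distribˡ _ _ _)) (*-congˡ (sym (•-distribʳ _ _ _))))) ⟩
      (q K.^ suc n) • (Y ^ suc n * X) + h • (q K.* [ n ]pq K.+ p K.^ n) • (Y ^ n * f * Z)
        ≈⟨ +-congˡ (*-congˡ (•-congʳ ([suc] n))) ⟨
      (q K.^ suc n) • (Y ^ suc n * X) + h • [ suc n ]pq • (Y ^ n * f * Z) ∎
      where
      first : q • (Y * ((q K.^ n) • (Y ^ n * X))) ≈ (q K.^ suc n) • (Y ^ suc n * X)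
      first = trans (*-congˡ (*-• _ _ _))
        (trans (sym (•-assoc _ _ _)) (*-congˡ (sym (*-assoc _ _ _))))
      middle : q • (Y * (h • [ n ]pq • (Y ^ ℕ.pred n * f * Z))) ≈
               h • (q K.* [ n ]pq) • (Y ^ n * f * Z)
      middle = begin
        q • (Y * (h • [ n ]pq • (Y ^ ℕ.pred n * f * Z)))
          ≈⟨ *-congˡ (trans (*-• _ _ _) (*-congˡ (*-• _ _ _))) ⟩
        q • h • [ n ]pq • (Y * (Y ^ ℕ.pred n * f * Z))    ≈⟨ •-comm _ _ _ ⟩
        h • q • [ n ]pq • (Y * (Y ^ ℕ.pred n * f * Z))
          ≈⟨ *-congˡ (*-congˡ (trans (*-congˡ (*-congˡ (*-assoc _ _ _)))
               (trans (Y*Y^pred n (f * Z)) (*-congˡ (sym (*-assoc _ _ _)))))) ⟩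
        h • q • [ n ]pq • (Y ^ n * f * Z)                 ≈⟨ *-congˡ (•-assoc _ _ _) ⟨
        h • (q K.* [ n ]pq) • (Y ^ n * f * Z)             ∎
      last : f * (Z * Y ^ n) ≈ (p K.^ n) • (Y ^ n * f * Z)
      last = begin
        f * (Z * Y ^ n)                   ≈⟨ *-congˡ (^-q-comm Z Y ZY n) ⟩
        f * ((p K.^ n) • (Y ^ n * Z))     ≈⟨ *-• _ _ _ ⟩
        (p K.^ n) • (f * (Y ^ n * Z))     ≈⟨ *-congˡ (*-assoc _ _ _) ⟨
        (p K.^ n) • (f * Y ^ n * Z)       ≈⟨ *-congˡ (*-congʳ (^-*-comm f Y fY n)) ⟩
        (p K.^ n) • (Y ^ n * f * Z)       ∎

    -- In the main term the surviving `X` still has to cross `Z ^ d`, at the cost of `p ^ d`. In the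
    -- other term the new `Z` already stands next to `Z ^ d`.
    X*monomial : ∀ n d w → X * (Y ^ n * (Z ^ d * X ^ w)) ≈
      (q K.^ n K.* p K.^ d) • (Y ^ n * (Z ^ d * X ^ suc w))
        + h • [ n ]pq • (Y ^ ℕ.pred n * f * (Z ^ suc d * X ^ w))
    X*monomial n d w = begin
      X * (Y ^ n * V)
        ≈⟨ *-assoc _ _ _ ⟨
      X * Y ^ n * V
        ≈⟨ *-congʳ (X*Y^ n) ⟩
      ((q K.^ n) • (Y ^ n * X) + h • [ n ]pq • (Y ^ ℕ.pred n * f * Z)) * V
        ≈⟨ distribʳ _ _ _ ⟩
      ((q K.^ n) • (Y ^ n * X)) * V + (h • [ n ]pq • (Y ^ ℕ.pred n * f * Z)) * V
        ≈⟨ +-cong first second ⟩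
      (q K.^ n K.* p K.^ d) • (Y ^ n * (Z ^ d * X ^ suc w))
        + h • [ n ]pq • (Y ^ ℕ.pred n * f * (Z ^ suc d * X ^ w)) ∎
      where
      V = Z ^ d * X ^ w
      first : ((q K.^ n) • (Y ^ n * X)) * V ≈ (q K.^ n K.* p K.^ d) • (Y ^ n * (Z ^ d * X ^ suc w))
      first = begin
        ((q K.^ n) • (Y ^ n * X)) * V
          ≈⟨ trans (*-assoc _ _ _) (*-congˡ (*-assoc _ _ _)) ⟩
        (q K.^ n) • (Y ^ n * (X * (Z ^ d * X ^ w)))
          ≈⟨ *-congˡ (*-congˡ (*-assoc _ _ _)) ⟨
        (q K.^ n) • (Y ^ n * (X * Z ^ d * X ^ w))
          ≈⟨ *-congˡ (*-congˡ (*-congʳ (^-q-comm X Z XZ d))) ⟩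
        (q K.^ n) • (Y ^ n * (((p K.^ d) • (Z ^ d * X)) * X ^ w))
          ≈⟨ *-congˡ (*-congˡ (trans (*-assoc _ _ _) (*-congˡ (*-assoc _ _ _)))) ⟩
        (q K.^ n) • (Y ^ n * ((p K.^ d) • (Z ^ d * X ^ suc w)))
          ≈⟨ *-congˡ (*-• _ _ _) ⟩
        (q K.^ n) • (p K.^ d) • (Y ^ n * (Z ^ d * X ^ suc w))
          ≈⟨ •-assoc _ _ _ ⟨
        (q K.^ n K.* p K.^ d) • (Y ^ n * (Z ^ d * X ^ suc w))  ∎
      second : (h • [ n ]pq • (Y ^ ℕ.pred n * f * Z)) * V ≈
               h • [ n ]pq • (Y ^ ℕ.pred n * f * (Z ^ suc d * X ^ w))
      second = trans (*-assoc _ _ _) (*-congˡ (trans (*-assoc _ _ _) (*-congˡ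
        (trans (*-assoc _ _ _) (*-congˡ (sym (*-assoc _ _ _)))))))

    -- Needed at two levels: for the index tuples inside one `G l`, and for the partitions in a box.
    X*sum : ∀ {b} {B : Set b} (xs : List B) {F P R : B → Carrier} {V V₁ V₂ : Carrier} →
      (∀ x → X * (F x * V) ≈ P x * V₁ + h • (R x * V₂)) →
      X * (sumOver xs F * V) ≈ sumOver xs P * V₁ + h • (sumOver xs R * V₂)
    X*sum xs {F} {P} {R} {V} {V₁} {V₂} step = begin
      X * (sumOver xs F * V)
        ≈⟨ trans (*-congˡ (*-distribʳ-sum V xs F)) (*-distribˡ-sum X xs _) ⟩
      (∑[ x ← xs ] X * (F x * V))
        ≈⟨ trans (sum-cong xs step) (sum-+ xs _ _) ⟩
      (∑[ x ← xs ] P x * V₁) + (∑[ x ← xs ] h • (R x * V₂))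
        ≈⟨ +-cong (*-distribʳ-sum V₁ xs P)
                  (trans (*-congˡ (*-distribʳ-sum V₂ xs R)) (*-distribˡ-sum _ xs _)) ⟨
      sumOver xs P * V₁ + h • (sumOver xs R * V₂) ∎

    -- g with the cases d = 0 and d ≥ 1 merged.
    G : ∀ {d} → Vec ℕ d → Carrier
    G {d} l = ∑[ t ← tuples (allFin (suc s)) d ] coeff l t • Y ^ height (Vec.map toℕ t) d

    G≈g : ∀ {d} (l : Vec ℕ d) → G l ≈ g s α l Y
    G≈g {zero} [] = begin
      (K.1# K.* K.1# K.* K.1#) • (Y * 1#) + 0#
        ≈⟨ +-identityʳ _ ⟩
      (K.1# K.* K.1# K.* K.1#) • (Y * 1#)
        ≈⟨ •-congʳ (K.trans (K.*-identityʳ _) (K.*-identityʳ _)) ⟩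
      K.1# • (Y * 1#)
        ≈⟨ trans (•-identityˡ _) (*-identityʳ Y) ⟩
      Y ∎
    -- `coeff` is bracketed as in `g`, and `ℕ.pred (suc d)` reduces, so both sides unfold to the
    -- same sum.
    G≈g {suc d} l = refl

    •G : ∀ k {d} (l : Vec ℕ d) →
      k • G l ≈ ∑[ t ← tuples (allFin (suc s)) d ] (k K.* coeff l t) • Y ^ height (Vec.map toℕ t) d
    •G k {d} l = trans (*-distribˡ-sum (ι k) ts _) (sum-cong ts (λ t → sym (•-assoc k _ _)))
      where ts = tuples (allFin (suc s)) d

    append-part : ∀ {d} k (l : Vec ℕ d) (t : Vec (Fin (suc s)) d) →
      let n = height (Vec.map toℕ t) d in
      (k K.* coeff l t) • [ n ]pq • (Y ^ ℕ.pred n * f) ≈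
      (∑[ x ← allFin (suc s) ]
        (k K.* coeff (l ∷ʳ 0) (t ∷ʳ x)) • Y ^ height (Vec.map toℕ (t ∷ʳ x)) (suc d))
    append-part {d} k l t = begin
      (k K.* coeff l t) • [ n ]pq • (Y ^ ℕ.pred n * f)
        ≈⟨ *-congˡ (*-congˡ (*-distribˡ-sum _ xs _)) ⟩
      (k K.* coeff l t) • [ n ]pq • (∑[ x ← xs ] Y ^ ℕ.pred n * (α x • Y ^ toℕ x))
        ≈⟨ trans (*-congˡ (*-distribˡ-sum _ xs _)) (*-distribˡ-sum _ xs _) ⟩
      (∑[ x ← xs ] (k K.* coeff l t) • [ n ]pq • (Y ^ ℕ.pred n * (α x • Y ^ toℕ x)))
        ≈⟨ sum-cong xs (λ x → trans (collect x) (exponent x)) ⟩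
      (∑[ x ← xs ] (k K.* coeff (l ∷ʳ 0) (t ∷ʳ x)) • Y ^ height (Vec.map toℕ (t ∷ʳ x)) (suc d)) ∎
      where
      xs = allFin (suc s)
      i = Vec.map toℕ t
      n = height i d
      collect : ∀ x → (k K.* coeff l t) • [ n ]pq • (Y ^ ℕ.pred n * (α x • Y ^ toℕ x)) ≈
                      (k K.* coeff (l ∷ʳ 0) (t ∷ʳ x)) • Y ^ (ℕ.pred n ℕ.+ toℕ x)
      collect x = begin
        (k K.* coeff l t) • [ n ]pq • (Y ^ ℕ.pred n * (α x • Y ^ toℕ x))
          ≈⟨ *-congˡ (*-congˡ (trans (*-• _ _ _) (*-congˡ (sym (^-homo-* Y (ℕ.pred n) (toℕ x)))))) ⟩
        (k K.* coeff l t) • [ n ]pq • α x • Y ^ (ℕ.pred n ℕ.+ toℕ x)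
          ≈⟨ trans (•-assoc _ _ _) (•-assoc _ _ _) ⟨
        (k K.* coeff l t K.* [ n ]pq K.* α x) • Y ^ (ℕ.pred n ℕ.+ toℕ x)
          ≈⟨ •-congʳ (K.trans (K.*-congʳ (K.*-assoc _ _ _))
               (K.trans (K.*-assoc _ _ _) (K.*-congˡ (K.sym (coeff-∷ʳ0 l t x))))) ⟩
        (k K.* coeff (l ∷ʳ 0) (t ∷ʳ x)) • Y ^ (ℕ.pred n ℕ.+ toℕ x) ∎
      exponent : ∀ x → (k K.* coeff (l ∷ʳ 0) (t ∷ʳ x)) • Y ^ (ℕ.pred n ℕ.+ toℕ x) ≈
                       (k K.* coeff (l ∷ʳ 0) (t ∷ʳ x)) • Y ^ height (Vec.map toℕ (t ∷ʳ x)) (suc d)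
      exponent x with n ℕ.≟ 0
      ... | no n≢0 = *-congˡ (^-congʳ Y (≡.sym (≡.trans
        (cong (λ i → height i (suc d)) (Vec.map-∷ʳ toℕ x t)) (height-full-∷ʳ i (toℕ x) n≢0))))
      -- The exponents may differ here, but the coefficient contains `[ n ]`, which is `[ 0 ]`.
      ... | yes n≡0 = trans (•-zero _ vanish) (sym (•-zero _ vanish))
        where
        vanish : k K.* coeff (l ∷ʳ 0) (t ∷ʳ x) K.≈ K.0#
        vanish = K.trans (K.*-congˡ (K.trans (coeff-∷ʳ0 l t x) (K.trans (K.*-congʳ (K.trans
          (K.*-congˡ (K.trans (K.reflexive (cong [_]pq n≡0)) [0]))
          (K.zeroʳ _))) (K.zeroˡ _)))) (K.zeroʳ _)

    X*weighted-G : ∀ w {d} (l : Vec ℕ d) →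
      X * ((weight w l • G l) * (Z ^ d * X ^ w)) ≈
      (weight (suc w) (Vec.map suc l) • G (Vec.map suc l)) * (Z ^ d * X ^ suc w)
        + h • ((weight w (l ∷ʳ 0) • G (l ∷ʳ 0)) * (Z ^ suc d * X ^ w))
    X*weighted-G w {d} l = begin
      X * ((weight w l • G l) * V)
        ≈⟨ *-congˡ (*-congʳ (•G _ l)) ⟩
      X * ((∑[ t ← ts ] (weight w l K.* coeff l t) • Y ^ N t) * V)
        ≈⟨ X*sum ts step ⟩
      (∑[ t ← ts ] (weight (suc w) (Vec.map suc l) K.* coeff (Vec.map suc l) t) • Y ^ N t) * V₁
        + h • ((∑[ t ← ts ] ∑[ x ← xs ] R (t ∷ʳ x)) * V₂)
        -- The pairs of `t` and `x` run through the tuples of length `suc d`, which are the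
        -- summation range of `G (l ∷ʳ 0)`.
        ≈⟨ +-cong (*-congʳ (•G _ (Vec.map suc l)))
             (*-congˡ (*-congʳ (trans (•G _ (l ∷ʳ 0)) (sum-tuples-∷ʳ xs d R)))) ⟨
      (weight (suc w) (Vec.map suc l) • G (Vec.map suc l)) * V₁
        + h • ((weight w (l ∷ʳ 0) • G (l ∷ʳ 0)) * V₂) ∎
      where
      xs = allFin (suc s)
      ts = tuples xs d
      V  = Z ^ d * X ^ w
      V₁ = Z ^ d * X ^ suc w
      V₂ = Z ^ suc d * X ^ w
      N : Vec (Fin (suc s)) d → ℕ
      N t = height (Vec.map toℕ t) d
      R : Vec (Fin (suc s)) (suc d) → Carrier
      R u = (weight w (l ∷ʳ 0) K.* coeff (l ∷ʳ 0) u) • Y ^ height (Vec.map toℕ u) (suc d)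
      step : ∀ t → X * (((weight w l K.* coeff l t) • Y ^ N t) * V) ≈
        ((weight (suc w) (Vec.map suc l) K.* coeff (Vec.map suc l) t) • Y ^ N t) * V₁
          + h • ((∑[ x ← xs ] R (t ∷ʳ x)) * V₂)
      step t = begin
        X * ((κ • Y ^ N t) * V)
          ≈⟨ trans (*-congˡ (*-assoc _ _ _)) (*-• _ _ _) ⟩
        κ • (X * (Y ^ N t * V))
          ≈⟨ trans (*-congˡ (X*monomial (N t) d w)) (distribˡ _ _ _) ⟩
        κ • (q K.^ N t K.* p K.^ d) • (Y ^ N t * V₁) + κ • h • [ N t ]pq • (Y ^ ℕ.pred (N t) * f * V₂)
          ≈⟨ +-cong
               (trans (sym (•-assoc _ _ _))
                 (trans (•-congʳ (coeff-map-suc w l t)) (sym (*-assoc _ _ _))))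
               (trans (•-comm _ _ _)
                 (*-congˡ (trans (*-congˡ (sym (*-assoc _ _ _))) (sym (*-assoc _ _ _))))) ⟩
        ((weight (suc w) (Vec.map suc l) K.* coeff (Vec.map suc l) t) • Y ^ N t) * V₁
          + h • ((κ • [ N t ]pq • (Y ^ ℕ.pred (N t) * f)) * V₂)
          ≈⟨ +-congˡ (*-congˡ (*-congʳ (trans (•-congʳ (K.*-congʳ (K.sym (weight-∷ʳ0 w l))))
                                                  (append-part (weight w (l ∷ʳ 0)) l t)))) ⟩
        ((weight (suc w) (Vec.map suc l) K.* coeff (Vec.map suc l) t) • Y ^ N t) * V₁
          + h • ((∑[ x ← xs ] R (t ∷ʳ x)) * V₂) ∎
        where
        κ = weight w l K.* coeff l t

    boxSum : ℕ → ℕ → Carrier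
    boxSum w j = ∑[ l ← 𝓘 w j ] weight w l • G l

    -- The share of `boxSum (suc w) j` that comes from partitions with all parts positive.
    shiftedSum : ℕ → ℕ → Carrier
    shiftedSum w j = ∑[ l ← 𝓘 w j ] weight (suc w) (Vec.map suc l) • G (Vec.map suc l)

    -- The share of `boxSum w (suc j)` that comes from partitions with last part 0.
    appendedSum : ℕ → ℕ → Carrier
    appendedSum w j = ∑[ l ← 𝓘 w j ] weight w (l ∷ʳ 0) • G (l ∷ʳ 0)

    boxSum-zero : ∀ j → boxSum 0 (suc j) ≈ appendedSum 0 j
    boxSum-zero j = trans (sum-↭ _ (𝓘-zero j)) (sum-map (_∷ʳ 0) (𝓘 0 j) _)

    boxSum-suc : ∀ w j → boxSum (suc w) (suc j) ≈ shiftedSum w (suc j) + appendedSum (suc w) j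
    boxSum-suc w j = trans (sum-↭ _ (𝓘-split w j)) (trans
      (sum-++ (List.map (Vec.map suc) (𝓘 w (suc j))) _ _)
      (+-cong (sum-map (Vec.map suc) (𝓘 w (suc j)) _) (sum-map (_∷ʳ 0) (𝓘 (suc w) j) _)))

    -- `P` and `R` are indexed by the position `(w , j)` from which they arise; their monomials in
    -- `Z` and `X` are those of `T` at `(suc w , j)` and at `(w , suc j)`.
    T P R : ℕ → ℕ → Carrier
    T w j = (h K.^ j) • (boxSum w j * (Z ^ j * X ^ w))
    P w j = (h K.^ j) • (shiftedSum w j * (Z ^ j * X ^ suc w))
    R w j = (h K.^ suc j) • (appendedSum w j * (Z ^ suc j * X ^ w))

    X*T : ∀ w j → X * T w j ≈ P w j + R w j
    X*T w j = begin
      X * T w j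
        ≈⟨ *-• _ _ _ ⟩
      (h K.^ j) • (X * (boxSum w j * (Z ^ j * X ^ w)))
        ≈⟨ *-congˡ (X*sum (𝓘 w j) (X*weighted-G w)) ⟩
      (h K.^ j) • (shiftedSum w j * (Z ^ j * X ^ suc w) + h • (appendedSum w j * (Z ^ suc j * X ^ w)))
        ≈⟨ distribˡ _ _ _ ⟩
      P w j + (h K.^ j) • h • (appendedSum w j * (Z ^ suc j * X ^ w))
        ≈⟨ +-congˡ (trans (•-comm _ _ _) (sym (•-assoc _ _ _))) ⟩
      P w j + R w j ∎

    T-suc : ∀ w j → T (suc w) (suc j) ≈ P w (suc j) + R (suc w) j
    T-suc w j = trans
      (*-congˡ (trans (*-congʳ (boxSum-suc w j)) (distribʳ _ _ _)))
      (distribˡ _ _ _)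

    X^*Y : ∀ m → X ^ m * Y ≈ antidiagonal T m 0
    X^*Y zero = begin
      1# * Y                                                          ≈⟨ *-identityˡ Y ⟩
      Y                                                               ≈⟨ G≈g [] ⟨
      G []                                                            ≈⟨ •-identityˡ _ ⟨
      K.1# • G []                                                     ≈⟨ •-congʳ (K.*-identityʳ _) ⟨
      weight 0 [] • G []                                              ≈⟨ +-identityʳ _ ⟨
      boxSum 0 0                                                      ≈⟨ *-identityʳ _ ⟨
      boxSum 0 0 * 1#                                                 ≈⟨ *-congˡ (*-identityʳ 1#) ⟨
      boxSum 0 0 * (1# * 1#)                                          ≈⟨ •-identityˡ _ ⟨
      T 0 0                                                           ∎
    X^*Y (suc m) = begin
      X * X ^ m * Y                             ≈⟨ *-assoc _ _ _ ⟩
      X * (X ^ m * Y)                           ≈⟨ *-congˡ (X^*Y m) ⟩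
      X * antidiagonal T m 0                    ≈⟨ *-antidiagonal X X*T m 0 ⟩
      antidiagonal (λ w j → P w j + R w j) m 0
        -- The separate summand `P m 0` is `T (suc m) 0` by computation: the only partition without
        -- parts is `[]`, and `map suc` fixes it.
        ≈⟨ antidiagonal-shift P R T (λ j → *-congˡ (*-congʳ (boxSum-zero j))) T-suc m 0 ⟩
      antidiagonal T (suc m) 0                  ∎

    term : ℕ → ℕ → Carrier
    term w j = (h K.^ j) • ((∑[ l ← 𝓘 w j ] weight w l • g s α l Y) * (Z ^ j * X ^ w))

    T≈term : ∀ w j → T w j ≈ term w j
    T≈term w j = *-congˡ (*-congʳ (sum-cong (𝓘 w j) (λ l → *-congˡ (G≈g l))))

    X^*Y≈sum : ∀ m → X ^ m * Y ≈ ∑[ j ← upTo (suc m) ] term (m ∸ j) j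
    X^*Y≈sum m = begin
      X ^ m * Y                             ≈⟨ X^*Y m ⟩
      antidiagonal T m 0                    ≈⟨ sum-antidiagonal T m 0 id (λ _ → ≡.refl) ⟨
      (∑[ j ← upTo (suc m) ] T (m ∸ j) j)   ≈⟨ sum-cong (upTo (suc m)) (λ j → T≈term (m ∸ j) j) ⟩
      (∑[ j ← upTo (suc m) ] term (m ∸ j) j) ∎

    G-normalOrdered : ∀ {d} (l : Vec ℕ d) v w → NormalOrdered X Y Z (G l * (Z ^ v * X ^ w))
    G-normalOrdered {d} l v w = NO-resp-≈ (sym (*-distribʳ-sum _ ts _)) (NO-sum ts (λ t →
      NO-resp-≈ (trans (*-congˡ (*-assoc _ _ _)) (sym (*-assoc _ _ _)))
        (NO-monomial (coeff l t) (height (Vec.map toℕ t) d) v w)))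
      where ts = tuples (allFin (suc s)) d

    term-normalOrdered : ∀ w j → NormalOrdered X Y Z (term w j)
    term-normalOrdered w j = NO-resp-≈ (T≈term w j) (NO-• (h K.^ j)
      (NO-resp-≈ (sym (*-distribʳ-sum _ (𝓘 w j) _)) (NO-sum (𝓘 w j) (λ l →
        NO-resp-≈ (sym (*-assoc _ _ _)) (NO-• (weight w l) (G-normalOrdered l j w))))))

theorem2p7 :
    ∀ {c ℓ a ℓ′} (S : PQScalars c ℓ)
    (𝒜 : UnitalAlgebra (PQScalars.commutativeRing S) a ℓ′) →
    let module K = PQScalars S
        open UnitalAlgebra 𝒜
        open RingOps ring
        open NormalOrdering S 𝒜
    in
    (h : K.Carrier) (s : ℕ) (α : Fin (ℕ.suc s) → K.Carrier)
    (X Y Z : Carrier) →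
    X * Y - K.q • (Y * X) ≈ h • (poly s α Y * Z) →
    Z * Y ≈ K.p • (Y * Z) →
    X * Z ≈ K.p • (Z * X) →
    (K.p K.≈ K.1# → Z ≈ 1#) →
    (m : ℕ) →
    let rhs = ∑[ j ← upTo (ℕ.suc m) ]
          ((h K.^ j) • ((∑[ lam ← 𝓘 (m ∸ j) j ]
                          ((K.q^ᶻ ((m ∸ j) ⊖ ∣ lam ∣) K.* (K.p K.^ ∣ lam ∣)) • g s α lam Y))
                        * (Z ^ j * X ^ (m ∸ j))))
    in
    X ^ m * Y ≈ rhs × NormalOrdered X Y Z rhs
theorem2p7 S 𝒜 h s α X Y Z XY ZY XZ _ m =
  X^*Y≈sum X Y Z XY ZY XZ m ,
  NO-sum (upTo (suc m)) (λ j → term-normalOrdered X Y Z XY ZY XZ (m ∸ j) j)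
  where
  open Commutation S 𝒜 h s α
  open ScalarAction.NormalOrderedProperties S 𝒜 X Y Z
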